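{- Let $G$ be a finite simple undirected graph with $s\ge 0$ isolated vertices, and let $k$ be the minimum, over all coding sequences $\sigma$ of $G$, of the number of distinct prime factors of $\lambda(\sigma)$. Then $\theta_t(G)=k+s$.
   Context: A clique is a set of pairwise adjacent vertices; a set $S$ of cliques of $G$ is a total clique covering if every vertex lies in some member of $S$ and every edge has both endpoints in some member of $S$. $\theta_t(G)$, the total clique covering number, is the minimum size of a total clique covering of $G$. For a finite sequence $\sigma=(a_1,\ldots,a_m)$ of positive integers, $G[\sigma]$ is the graph on $v_1,\ldots,v_m$ with $v_iv_j$ an edge iff $i\neq j$ and $\gcd(a_i,a_j)>1$. A coding sequence of $G$: if $G$ has one vertex, $\sigma=(1)$; otherwise, with $G_1$ obtained by deleting the isolated vertices of $G$, take a non-decreasing finite sequence $\sigma_1$ of square-free integers $>1$ with $G_1\cong G[\sigma_1]$ and prefix it by $s$ entries equal to $1$ (so $G\cong G[\sigma]$). $\lambda(\sigma)$ is the least common multiple of the entries of $\sigma$ that are greater than $1$. -}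

module Defs where

open import Data.Fin.Base using (Fin)
import Data.Fin.Properties as Fin
open import Data.Fin.Subset using (Subset; _∈_)
open import Data.List.Base using (List; []; _∷_; _++_; length; lookup; filter; foldr; replicate; allFin; upTo)
open import Data.List.Relation.Unary.All using (All)
open import Data.List.Relation.Unary.Any using (Any)
open import Data.List.Relation.Unary.Sorted.TotalOrder using (Sorted)
open import Data.List.Relation.Unary.Unique.Propositional using (Unique)
open import Data.Nat.Base using (ℕ; suc; _*_; _≤_; _<_)
open import Data.Nat.Divisibility using (_∣_; _∣?_)
open import Data.Nat.GCD using (gcd; gcd-comm)
open import Data.Nat.LCM using (lcm)
open import Data.Nat.Primality using (prime?)
open import Data.Nat.Properties using (_<?_; ≤-antisym; ≤-totalOrder)
open import Data.Product.Base using (_×_; _,_; ∃-syntax)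
open import Data.Refinement using (Refinement; value)
open import Function.Base using (_∘_)
open import Function.Bundles using (_⇔_; _⤖_; module Bijection)
open import Level using (0ℓ)
open import Relation.Binary.Core using (Rel)
open import Relation.Binary.Definitions using (Decidable; Symmetric)
open import Relation.Binary.PropositionalEquality using (_≡_; _≢_; refl; sym; subst)
open import Relation.Nullary.Decidable using (Dec; ¬?; _×-dec_)
open import Relation.Nullary.Negation using (¬_)

IsMinimum : (ℕ → Set) → ℕ → Set
IsMinimum P m = P m × (∀ k → P k → m ≤ k)

IsMinimum-unique : ∀ {P m n} → IsMinimum P m → IsMinimum P n → m ≡ n
IsMinimum-unique (pm , m≤) (pn , n≤) = ≤-antisym (m≤ _ pn) (n≤ _ pm)

record Graph (V : Set) : Set₁ where
  field
    Adj    : Rel V 0ℓ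
    adj?   : Decidable Adj
    symm   : Symmetric Adj
    irrefl : ∀ {v} → ¬ Adj v v

open Graph public

record _≅_ {V W : Set} (G : Graph V) (H : Graph W) : Set where
  field
    bijection : V ⤖ W
  open Bijection bijection using (to)
  field
    adj⇔ : ∀ u v → Adj G u v ⇔ Adj H (to u) (to v)

Isolated : ∀ {V} → Graph V → V → Set
Isolated G v = ∀ w → ¬ Adj G v w

isolated? : ∀ {n} (G : Graph (Fin n)) (v : Fin n) → Dec (Isolated G v)
isolated? G v = Fin.all? (λ w → ¬? (adj? G v w))

isolatedCount : ∀ {n} → Graph (Fin n) → ℕ
isolatedCount {n} G = length (filter (isolated? G) (allFin n))

-- A refinement carries its membership proof irrelevantly, so distinct
-- elements of the new vertex type are distinct vertices of G.
deleteIsolated : ∀ {V} (G : Graph V) → Graph (Refinement V (¬_ ∘ Isolated G))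
deleteIsolated G = record
  { Adj    = λ u v → Adj G (value u) (value v)
  ; adj?   = λ u v → adj? G (value u) (value v)
  ; symm   = symm G
  ; irrefl = irrefl G
  }

IsClique : ∀ {n} → Graph (Fin n) → Subset n → Set
IsClique G C = ∀ {u v} → u ∈ C → v ∈ C → u ≢ v → Adj G u v

record IsTotalCliqueCovering {n} (G : Graph (Fin n)) (S : List (Subset n)) : Set where
  field
    distinct       : Unique S
    cliques        : All (IsClique G) S
    coversVertices : ∀ v → Any (λ C → v ∈ C) S
    coversEdges    : ∀ u v → Adj G u v → Any (λ C → u ∈ C × v ∈ C) S

IsTotalCliqueCoveringNumber : ∀ {n} → Graph (Fin n) → ℕ → Set
IsTotalCliqueCoveringNumber G =
  IsMinimum (λ m → ∃[ S ] (IsTotalCliqueCovering G S × m ≡ length S))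

G[_] : (σ : List ℕ) → Graph (Fin (length σ))
G[ σ ] = record
  { Adj    = λ i j → i ≢ j × 1 < gcd (lookup σ i) (lookup σ j)
  ; adj?   = λ i j → ¬? (i Fin.≟ j) ×-dec (1 <? gcd (lookup σ i) (lookup σ j))
  ; symm   = λ {i} {j} (i≢j , 1<g) →
      i≢j ∘ sym , subst (1 <_) (gcd-comm (lookup σ i) (lookup σ j)) 1<g
  ; irrefl = λ (v≢v , _) → v≢v refl
  }

SquareFree : ℕ → Set
SquareFree n = ∀ d → d * d ∣ n → d ≡ 1

data IsCodingSequence {n} (G : Graph (Fin n)) : List ℕ → Set where
  oneVertex : n ≡ 1 → IsCodingSequence G (1 ∷ [])
  otherwise : n ≢ 1 → (σ₁ : List ℕ) →
              Sorted ≤-totalOrder σ₁ →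
              All (λ a → 1 < a × SquareFree a) σ₁ →
              deleteIsolated G ≅ G[ σ₁ ] →
              IsCodingSequence G (replicate (isolatedCount G) 1 ++ σ₁)

-- λ(σ); the empty least common multiple is 1.
lcm>1 : List ℕ → ℕ
lcm>1 σ = foldr lcm 1 (filter (1 <?_) σ)

-- The number of distinct prime factors of m for m > 0 (for m = 0 it is 0).
ω : ℕ → ℕ
ω m = length (filter (λ p → prime? p ×-dec p ∣? m) (upTo (suc m)))

IsMinimumPrimeCount : ∀ {n} → Graph (Fin n) → ℕ → Set
IsMinimumPrimeCount G =
  IsMinimum (λ m → ∃[ σ ] (IsCodingSequence G σ × m ≡ ω (lcm>1 σ)))

{-# OPTIONS --safe #-}
-- A prime p yields the clique of all vertices whose code is divisible by p; together with the
-- singletons of the isolated vertices these cliques form a total clique covering. Conversely, a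
-- clique containing an isolated vertex is a singleton, so at least s members of a total covering
-- are of this kind; give the other members distinct primes and code each remaining vertex by the
-- product of the primes of the cliques containing it.
module Submission where

open import Defs
open import Data.Nat.Base using (ℕ; _+_)
open import Data.Fin.Base using (Fin)
open import Data.Product.Base using (_×_; ∃-syntax)
open import Relation.Binary.PropositionalEquality using (_≡_)

open import Data.Bool.Properties using () renaming (_≟_ to _≟ᵇ_)
open import Data.Fin.Base using (zero; suc; toℕ; cast)
import Data.Fin.Properties as Fin
open import Data.Fin.Subset using (Subset; ⁅_⁆; _∪_) renaming (_∈_ to _∈ˢ_)
open import Data.Fin.Subset.Properties using (anySubset?; _∈?_; ⊆-antisym; x∈⁅x⁆; x∈⁅y⁆⇒x≡y; x∈p∪q⁺; x∈p∪q⁻)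
open import Data.Irrelevant using ([_])
open import Data.List.Base using (List; []; _∷_; _++_; length; lookup; map; filter; foldr; replicate; allFin; upTo; deduplicate; cartesianProductWith)
open import Data.List.Membership.Propositional using (_∈_; find; lose)
open import Data.List.Membership.Propositional.Properties
open import Data.List.Properties using (length-map; length-++; length-deduplicate; length-filter; length-tabulate)
open import Data.List.Relation.Binary.Permutation.Propositional using (_↭_; ↭-sym; ↭⇒↭ₛ)
open import Data.List.Relation.Binary.Permutation.Propositional.Properties using (∈-resp-↭; ↭-length; shift)
import Data.List.Relation.Binary.Permutation.Setoid.Properties as Permutationₛ
open import Data.List.Relation.Unary.All as All using (All; []; _∷_)
import Data.List.Relation.Unary.All.Properties as All
open import Data.List.Relation.Unary.AllPairs as AllPairs using ([]; _∷_)
open import Data.List.Relation.Unary.Any as Any using (Any; here; there; index)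
import Data.List.Relation.Unary.Any.Properties as Any
import Data.List.Relation.Unary.Linked.Properties as Linked
open import Data.List.Relation.Unary.Unique.Propositional using (Unique)
import Data.List.Relation.Unary.Unique.Propositional.Properties as Unique
import Data.List.Relation.Unary.Unique.DecPropositional.Properties as DecUnique
import Data.List.Sort as Sort
open import Data.Nat.Base using (zero; suc; _*_; _≤_; _<_; _!; z≤n; s≤s; z<s; >-nonZero; ≢-nonZero; ≢-nonZero⁻¹; nonTrivial⇒n>1)
open import Data.Nat.Divisibility using (_∣_; _∣?_; ∣-trans; ∣⇒≤; ∣1⇒≡1; ∣m+n∣m⇒∣n; m∣m*n; n∣m*n; *-pres-∣; *-cancelˡ-∣; m≤n⇒m!∣n!; 0∣⇒≡0)
open import Data.Nat.GCD using (gcd; gcd[m,n]∣m; gcd[m,n]∣n; gcd-greatest; gcd[m,n]≡0⇒m≡0)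
open import Data.Nat.Induction using (<-rec)
open import Data.Nat.LCM using (lcm; m∣lcm[m,n]; n∣lcm[m,n]; lcm-least)
open import Data.Nat.ListAction using (product)
open import Data.Nat.ListAction.Properties using (∈⇒∣product; product-↭)
open import Data.Nat.Primality using (Prime; prime?; ¬prime[0]; ¬prime[1]; prime⇒nonZero; prime⇒nonTrivial; euclidsLemma; productOfPrimes≢0)
open import Data.Nat.Primality.Factorisation using (factorise; factorisationHasAllPrimeFactors)
open import Data.Nat.Properties
open import Data.Product.Base using (∃; _,_; proj₁; proj₂)
open import Data.Refinement using (Refinement; value; _,_)
open import Data.Sum.Base using (_⊎_; inj₁; inj₂; [_,_]′)
import Data.Vec.Base as Vec
import Data.Vec.Properties as Vec
open import Function.Base using (_∘_; id)
open import Function.Bundles using (mk⇔; mk⤖; module Bijection; module Equivalence)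
import Relation.Binary.Construct.On as On
open import Relation.Binary.Definitions using (tri<; tri≈; tri>)
open import Relation.Binary.PropositionalEquality using (_≢_; refl; sym; trans; cong; cong₂; subst; subst₂; setoid; module ≡-Reasoning)
open import Relation.Nullary.Decidable using (Dec; yes; no; does; ¬?; map′; _×-dec_; _→-dec_; dec-true; decidable-stable; recompute)
open import Relation.Nullary.Negation using (¬_; contradiction)
open import Relation.Unary using (Decidable)

-- Supplies the covering number, a minimum that must be found by search. The minimal prime count
-- needs no search: it is read off from an optimal covering.
least : ∀ {P : ℕ → Set} → Decidable P → ∀ n → P n → ∃ (IsMinimum P)
least {P} P? = <-rec (λ n → P n → ∃ (IsMinimum P)) step
  where
  step : ∀ n → (∀ {m} → m < n → P m → ∃ (IsMinimum P)) → P n → ∃ (IsMinimum P)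
  step n rec pn with anyUpTo? P? n
  ... | yes (m , m<n , pm) = rec m<n pm
  ... | no ¬smaller = n , pn , λ k pk → ≮⇒≥ (λ k<n → ¬smaller (k , k<n , pk))

-- Lists without repetition

module _ {A : Set} where

  -- Pigeonhole: the head of `xs` is moved to the front of `ys` and dropped there, and the tail
  -- never meets it again. It bounds both the number of isolated vertices and the number of prime
  -- factors.
  unique⇒length≤ : ∀ {xs ys : List A} → Unique xs → (∀ {x} → x ∈ xs → x ∈ ys) → length xs ≤ length ys
  unique⇒length≤ [] _ = z≤n
  unique⇒length≤ {x ∷ xs} (x∉xs ∷ uniq) xs⊆ys with ∈-∃++ (xs⊆ys (here refl))
  ... | as , bs , refl = subst (suc (length xs) ≤_) (sym (↭-length ys↭)) (s≤s (unique⇒length≤ uniq rest))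
    where
    ys↭ = shift x as bs
    rest : ∀ {z} → z ∈ xs → z ∈ as ++ bs
    rest z∈xs with ∈-resp-↭ ys↭ (xs⊆ys (there z∈xs))
    ... | here refl = contradiction refl (All.lookup x∉xs z∈xs)
    ... | there z∈ = z∈

  unique-↭ : ∀ {xs ys : List A} → xs ↭ ys → Unique xs → Unique ys
  unique-↭ = Permutationₛ.Unique-resp-↭ (setoid A) ∘ ↭⇒↭ₛ

  lookup-injective : ∀ {xs : List A} → Unique xs → ∀ {i j} → lookup xs i ≡ lookup xs j → i ≡ j
  lookup-injective (_ ∷ _) {zero} {zero} _ = refl
  lookup-injective {x ∷ xs} (x∉xs ∷ _) {zero} {suc j} eq = contradiction eq (All.lookup x∉xs (∈-lookup j))
  lookup-injective {x ∷ xs} (x∉xs ∷ _) {suc i} {zero} eq = contradiction (sym eq) (All.lookup x∉xs (∈-lookup i))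
  lookup-injective (_ ∷ uniq) {suc i} {suc j} eq = cong suc (lookup-injective uniq eq)

  length-filter-¬ : ∀ {P : A → Set} (P? : Decidable P) xs →
                    length (filter (¬? ∘ P?) xs) + length (filter P? xs) ≡ length xs
  length-filter-¬ P? [] = refl
  length-filter-¬ P? (x ∷ xs) with P? x
  ... | yes _ = trans (+-suc _ _) (cong suc (length-filter-¬ P? xs))
  ... | no  _ = cong suc (length-filter-¬ P? xs)

  lookup-map-cast : ∀ {B : Set} (f : A → B) xs i → lookup (map f xs) (cast (sym (length-map f xs)) i) ≡ f (lookup xs i)
  lookup-map-cast f (x ∷ xs) zero = refl
  lookup-map-cast f (x ∷ xs) (suc i) = lookup-map-cast f xs i

-- Primes

primeDivisor : ∀ {n} → 1 < n → ∃[ p ] (Prime p × p ∣ n)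
primeDivisor {n} 1<n with factorise n {{>-nonZero (<-trans z<s 1<n)}}
... | record { factors = [] ; isFactorisation = n≡1 } = contradiction (sym n≡1) (<⇒≢ 1<n)
... | record { factors = p ∷ ps ; isFactorisation = n≡ ; factorsPrime = pp ∷ _ } =
  p , pp , subst (p ∣_) (sym n≡) (m∣m*n (product ps))

prime>1 : ∀ {p} → Prime p → 1 < p
prime>1 {p} pp = nonTrivial⇒n>1 p {{prime⇒nonTrivial pp}}

prime∣⇒>1 : ∀ {p n} → Prime p → p ∣ n → n ≢ 0 → 1 < n
prime∣⇒>1 pp p∣n n≢0 = <-≤-trans (prime>1 pp) (∣⇒≤ {{≢-nonZero n≢0}} p∣n)

gcd>1⇒prime : ∀ {m n} → 1 < gcd m n → ∃[ p ] (Prime p × p ∣ m × p ∣ n)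
gcd>1⇒prime {m} {n} 1<g with primeDivisor 1<g
... | p , pp , p∣g = p , pp , ∣-trans p∣g (gcd[m,n]∣m m n) , ∣-trans p∣g (gcd[m,n]∣n m n)

prime⇒gcd>1 : ∀ {m n p} → m ≢ 0 → Prime p → p ∣ m → p ∣ n → 1 < gcd m n
prime⇒gcd>1 m≢0 pp p∣m p∣n = prime∣⇒>1 pp (gcd-greatest p∣m p∣n) (m≢0 ∘ gcd[m,n]≡0⇒m≡0)

lcm∣m*n : ∀ m n → lcm m n ∣ m * n
lcm∣m*n m n = lcm-least {m} {n} (m∣m*n {m} n) (n∣m*n m {n})

prime∣lcm : ∀ {p} m n → Prime p → p ∣ lcm m n → p ∣ m ⊎ p ∣ n
prime∣lcm m n pp p∣l = euclidsLemma m n pp (∣-trans p∣l (lcm∣m*n m n))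

prime∤1 : ∀ {p} → Prime p → ¬ p ∣ 1
prime∤1 pp p∣1 = ¬prime[1] (subst Prime (∣1⇒≡1 p∣1) pp)

-- Euclid's argument: a prime divisor of `suc (n !)` that is at most `n` would divide `n !` and
-- hence 1.
greaterPrime : ∀ n → ∃[ p ] (Prime p × n < p)
greaterPrime n with primeDivisor {suc (n !)} (s≤s (1≤n! n))
... | p , pp , p∣ = p , pp , ≰⇒> λ p≤n → prime∤1 pp (∣m+n∣m⇒∣n (subst (p ∣_) (+-comm 1 (n !)) p∣) (p∣n! p≤n))
  where
  p∣p! : ∀ {q} → Prime q → q ∣ q !
  p∣p! {suc q} _ = m∣m*n (q !)
  p∣p! {zero} 0p = contradiction 0p ¬prime[0]
  p∣n! : p ≤ n → p ∣ n !
  p∣n! p≤n = ∣-trans (p∣p! pp) (m≤n⇒m!∣n! p≤n)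

-- Not the enumeration of all primes, since values may be skipped; the terms serve as distinct
-- labels for cliques.
primeSeq : ℕ → ℕ
primeSeq zero    = proj₁ (greaterPrime 0)
primeSeq (suc n) = proj₁ (greaterPrime (primeSeq n))

primeSeq-prime : ∀ n → Prime (primeSeq n)
primeSeq-prime zero    = proj₁ (proj₂ (greaterPrime 0))
primeSeq-prime (suc n) = proj₁ (proj₂ (greaterPrime (primeSeq n)))

primeSeq-mono-< : ∀ {m n} → m < n → primeSeq m < primeSeq n
primeSeq-mono-< {m} {suc n} (s≤s m≤n) with m≤n⇒m<n∨m≡n m≤n
... | inj₁ m<n  = <-trans (primeSeq-mono-< m<n) (proj₂ (proj₂ (greaterPrime (primeSeq n))))
... | inj₂ refl = proj₂ (proj₂ (greaterPrime (primeSeq n)))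

primeSeq-injective : ∀ {m n} → primeSeq m ≡ primeSeq n → m ≡ n
primeSeq-injective {m} {n} eq with <-cmp m n
... | tri< m<n _ _ = contradiction eq (<⇒≢ (primeSeq-mono-< m<n))
... | tri≈ _ m≡n _ = m≡n
... | tri> _ _ n<m = contradiction (sym eq) (<⇒≢ (primeSeq-mono-< n<m))

-- For `d` above 1, a prime `q` dividing `d` is one of the factors; cancelling it once leaves `q`
-- dividing the product of the others, so `q` would be listed twice. For `d` = 0 the square is 0,
-- which does not divide a nonzero product.
productOfDistinctPrimes-squareFree : ∀ {ps} → Unique ps → All Prime ps → SquareFree (product ps)
productOfDistinctPrimes-squareFree {ps} uniq primes 0 0∣Π =
  contradiction (0∣⇒≡0 0∣Π) (≢-nonZero⁻¹ _ {{productOfPrimes≢0 primes}})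
productOfDistinctPrimes-squareFree {ps} uniq primes 1 _ = refl
productOfDistinctPrimes-squareFree {ps} uniq primes d@(suc (suc _)) d²∣Π
  with primeDivisor {d} (s≤s z<s)
... | q , qp , q∣d with ∈-∃++ (factorisationHasAllPrimeFactors qp (∣-trans q∣d (∣-trans (m∣m*n d) d²∣Π)) primes)
... | as , bs , refl = contradiction q∈rest (Unique.Unique[x∷xs]⇒x∉xs (unique-↭ ps↭ uniq))
  where
  ps↭ = shift q as bs
  q∣rest : q ∣ product (as ++ bs)
  q∣rest = *-cancelˡ-∣ q {{prime⇒nonZero qp}}
    (subst (q * q ∣_) (product-↭ ps↭) (∣-trans (*-pres-∣ q∣d q∣d) d²∣Π))
  q∈rest : q ∈ as ++ bs
  q∈rest = factorisationHasAllPrimeFactors qp q∣rest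
    (All.tabulate λ x∈ → All.lookup primes (∈-resp-↭ (↭-sym ps↭) (there x∈)))

-- Prime factors of λ(σ)

∣lcm>1 : ∀ {a} σ → a ∈ σ → 1 < a → a ∣ lcm>1 σ
∣lcm>1 σ a∈σ 1<a = go (∈-filter⁺ (1 <?_) a∈σ 1<a)
  where
  go : ∀ {a xs} → a ∈ xs → a ∣ foldr lcm 1 xs
  go {xs = x ∷ xs} (here refl) = m∣lcm[m,n] x _
  go {xs = x ∷ xs} (there a∈) = ∣-trans (go a∈) (n∣lcm[m,n] x _)

prime∣lcm>1 : ∀ {p} σ → Prime p → p ∣ lcm>1 σ → ∃[ a ] (a ∈ σ × 1 < a × p ∣ a)
prime∣lcm>1 {p} σ pp p∣l =
  let a , a∈ , p∣a = find (go (filter (1 <?_) σ) p∣l)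
      a∈σ , 1<a = ∈-filter⁻ (1 <?_) a∈
  in a , a∈σ , 1<a , p∣a
  where
  go : ∀ xs → p ∣ foldr lcm 1 xs → Any (p ∣_) xs
  go [] p∣1 = contradiction p∣1 (prime∤1 pp)
  go (x ∷ xs) p∣ = [ here , there ∘ go xs ]′ (prime∣lcm x _ pp p∣)

-- Guards against the degenerate value of `ω` at 0: the search for prime factors stops at `m`, so at
-- `m` = 0 it would miss every prime. A zero `lcm` would divide, and so annihilate, the product of
-- its arguments.
lcm>1≢0 : ∀ σ → lcm>1 σ ≢ 0
lcm>1≢0 σ = go _ (All.all-filter (1 <?_) σ)
  where
  go : ∀ xs → All (1 <_) xs → foldr lcm 1 xs ≢ 0
  go [] [] ()
  go (x ∷ xs) (1<x ∷ all) l≡0 = [ (λ { refl → contradiction 1<x λ () }) , go xs all ]′ (m*n≡0⇒m≡0∨n≡0 x x*r≡0)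
    where
    r = foldr lcm 1 xs
    x*r≡0 : x * r ≡ 0
    x*r≡0 = 0∣⇒≡0 (subst (_∣ x * r) l≡0 (lcm∣m*n x r))

isPrimeFactor? : ∀ m → Decidable (λ p → Prime p × p ∣ m)
isPrimeFactor? m p = prime? p ×-dec p ∣? m

-- The list that `ω` counts: its length is `ω m` by definition.
primeFactors : ℕ → List ℕ
primeFactors m = filter (isPrimeFactor? m) (upTo (suc m))

∈-primeFactors⁺ : ∀ {p m} → m ≢ 0 → Prime p → p ∣ m → p ∈ primeFactors m
∈-primeFactors⁺ {m = m} m≢0 pp p∣m = ∈-filter⁺ (isPrimeFactor? m) (∈-upTo⁺ (s≤s (∣⇒≤ {{≢-nonZero m≢0}} p∣m))) (pp , p∣m)

∈-primeFactors⁻ : ∀ {p} m → p ∈ primeFactors m → Prime p × p ∣ m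
∈-primeFactors⁻ m p∈ = proj₂ (∈-filter⁻ (isPrimeFactor? m) {xs = upTo (suc m)} p∈)

-- Subsets and coverings

module _ {n} {P : Fin n → Set} (P? : Decidable P) where

  comprehension : Subset n
  comprehension = Vec.tabulate (does ∘ P?)

  ∈-comprehension⁺ : ∀ {v} → P v → v ∈ˢ comprehension
  ∈-comprehension⁺ {v} pv = Vec.lookup⇒[]= v _ (trans (Vec.lookup∘tabulate _ v) (dec-true (P? v) pv))

  ∈-comprehension⁻ : ∀ {v} → v ∈ˢ comprehension → P v
  ∈-comprehension⁻ {v} v∈ with P? v | trans (sym (Vec.lookup∘tabulate (does ∘ P?) v)) (Vec.[]=⇒lookup v∈)
  ... | yes pv | _ = pv
  ... | no _ | ()

-- Lists of subsets of a fixed length form a finite search space. This makes the existence of a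
-- covering of given size decidable, as `least` requires.
anyListOfLength? : ∀ {n} m {P : List (Subset n) → Set} → Decidable P → Dec (∃[ S ] (P S × m ≡ length S))
anyListOfLength? zero P? = map′ (λ p → [] , p , refl) (λ { ([] , p , _) → p }) (P? [])
anyListOfLength? (suc m) P? = map′
  (λ (C , S , p , eq) → C ∷ S , p , cong suc eq)
  (λ { (C ∷ S , p , eq) → C , S , p , suc-injective eq })
  (anySubset? (λ C → anyListOfLength? m (P? ∘ (C ∷_))))

module _ {n} (G : Graph (Fin n)) where

  isClique? : Decidable (IsClique G)
  isClique? C = map′ (λ h {u} {v} → h u v) (λ h u v → h)
    (Fin.all? λ u → Fin.all? λ v → (u ∈? C) →-dec ((v ∈? C) →-dec (¬? (u Fin.≟ v) →-dec adj? G u v)))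

  _≟ˢ_ : (C D : Subset n) → Dec (C ≡ D)
  _≟ˢ_ = Vec.≡-dec _≟ᵇ_

  isTotalCliqueCovering? : Decidable (IsTotalCliqueCovering G)
  isTotalCliqueCovering? S = map′
    (λ (d , c , v , e) → record { distinct = d ; cliques = c ; coversVertices = v ; coversEdges = e })
    (λ cov → let open IsTotalCliqueCovering cov in distinct , cliques , coversVertices , coversEdges)
    (AllPairs.allPairs? (λ C D → ¬? (C ≟ˢ D)) S
      ×-dec All.all? isClique? S
      ×-dec Fin.all? (λ v → Any.any? (v ∈?_) S)
      ×-dec Fin.all? (λ u → Fin.all? λ v → adj? G u v →-dec Any.any? (λ C → (u ∈? C) ×-dec (v ∈? C)) S))

  -- A covering must list distinct cliques, but the constructions below can repeat one: two primes
  -- may divide the codes of exactly the same vertices. Deduplication only shortens the list, which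
  -- is harmless for upper bounds.
  removeDuplicates : ∀ {S} → All (IsClique G) S → (∀ v → Any (v ∈ˢ_) S) →
    (∀ u v → Adj G u v → Any (λ C → u ∈ˢ C × v ∈ˢ C) S) →
    ∃[ S′ ] (IsTotalCliqueCovering G S′ × length S′ ≤ length S)
  removeDuplicates {S} cl cv ce = deduplicate _≟ˢ_ S , record
    { distinct       = DecUnique.deduplicate-! _≟ˢ_ S
    ; cliques        = All.deduplicate⁺ _≟ˢ_ cl
    ; coversVertices = dedupAny ∘ cv
    ; coversEdges    = λ u v → dedupAny ∘ ce u v
    } , length-deduplicate _≟ˢ_ S
    where
    dedupAny : ∀ {P : Subset n → Set} → Any P S → Any P (deduplicate _≟ˢ_ S)
    dedupAny = Any.deduplicate⁺ _≟ˢ_ λ { refl → id }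

  singleton-clique : ∀ v → IsClique G ⁅ v ⁆
  singleton-clique v a∈ b∈ a≢b = contradiction (trans (x∈⁅y⁆⇒x≡y v a∈) (sym (x∈⁅y⁆⇒x≡y v b∈))) a≢b

  pair-clique : ∀ {u v} → Adj G u v → IsClique G (⁅ u ⁆ ∪ ⁅ v ⁆)
  pair-clique {u} {v} uv a∈ b∈ a≢b with x∈p∪q⁻ _ _ a∈ | x∈p∪q⁻ _ _ b∈
  ... | inj₁ a | inj₁ b = singleton-clique u a b a≢b
  ... | inj₂ a | inj₂ b = singleton-clique v a b a≢b
  ... | inj₁ a | inj₂ b with refl ← x∈⁅y⁆⇒x≡y u a | refl ← x∈⁅y⁆⇒x≡y v b = uv
  ... | inj₂ a | inj₁ b with refl ← x∈⁅y⁆⇒x≡y v a | refl ← x∈⁅y⁆⇒x≡y u b = symm G uv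

  -- Some covering, to start the search for a least one: all singletons cover the vertices and the
  -- two-element cliques cover the edges.
  totalCliqueCovering : ∃ (IsTotalCliqueCovering G)
  totalCliqueCovering = let S′ , cov , _ = removeDuplicates {singletons ++ pairs} cl cv ce in S′ , cov
    where
    singletons = map ⁅_⁆ (allFin n)
    allPairs = cartesianProductWith (λ u v → ⁅ u ⁆ ∪ ⁅ v ⁆) (allFin n) (allFin n)
    -- Filtering by cliqueness also keeps the degenerate pairs with equal components; these repeat
    -- singletons and vanish on deduplication.
    pairs = filter isClique? allPairs
    cl : All (IsClique G) (singletons ++ pairs)
    cl = All.++⁺ (All.map⁺ {xs = allFin n} (All.tabulate λ {v} _ → singleton-clique v)) (All.all-filter isClique? allPairs)
    cv : ∀ v → Any (v ∈ˢ_) (singletons ++ pairs)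
    cv v = lose (∈-++⁺ˡ (∈-map⁺ ⁅_⁆ (∈-allFin v))) (x∈⁅x⁆ v)
    ce : ∀ u v → Adj G u v → Any (λ C → u ∈ˢ C × v ∈ˢ C) (singletons ++ pairs)
    ce u v uv = lose
      (∈-++⁺ʳ singletons (∈-filter⁺ isClique?
        (∈-cartesianProductWith⁺ _ (∈-allFin u) (∈-allFin v)) (pair-clique uv)))
      (x∈p∪q⁺ (inj₁ (x∈⁅x⁆ u)) , x∈p∪q⁺ (inj₂ (x∈⁅x⁆ v)))

  cliqueCoveringNumber : ∃ (IsTotalCliqueCoveringNumber G)
  cliqueCoveringNumber with S , cov ← totalCliqueCovering =
    least (λ m → anyListOfLength? m isTotalCliqueCovering?) (length S) (S , cov , refl)

  isolatedVertices : List (Fin n)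
  isolatedVertices = filter (isolated? G) (allFin n)

  ¬isolated⇒adj : ∀ {v} → ¬ Isolated G v → ∃[ w ] Adj G v w
  ¬isolated⇒adj {v} ¬iso with Fin.¬∀⟶∃¬ n _ (λ w → ¬? (adj? G v w)) ¬iso
  ... | w , ¬¬vw = w , decidable-stable (adj? G v w) ¬¬vw

-- From coding sequences to coverings

module _ {n} (G : Graph (Fin n)) (σ : List ℕ) (>1 : All (1 <_) σ) (iso : deleteIsolated G ≅ G[ σ ]) where
  open _≅_ iso
  open Bijection bijection using (to; injective)

  private
    -- The decision is an argument because only its `no` case yields a vertex of `deleteIsolated G`.
    -- The default 1 is divisible by no prime and so keeps isolated vertices out of every block.
    code : (v : Fin n) → Dec (Isolated G v) → ℕ
    code v (yes _)    = 1
    code v (no ¬isol) = lookup σ (to (v , [ ¬isol ]))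

    divisible? : ∀ p → Decidable (λ v → p ∣ code v (isolated? G v))
    divisible? p v = p ∣? code v (isolated? G v)

    block : ℕ → Subset n
    block p = comprehension (divisible? p)

    block-clique : ∀ {p} → Prime p → IsClique G (block p)
    block-clique {p} pp {u} {v} u∈ v∈ u≢v
      with isolated? G u | ∈-comprehension⁻ (divisible? p) u∈
         | isolated? G v | ∈-comprehension⁻ (divisible? p) v∈
    ... | yes _ | p∣1 | _ | _ = contradiction p∣1 (prime∤1 pp)
    ... | no _ | _ | yes _ | p∣1 = contradiction p∣1 (prime∤1 pp)
    ... | no _ | p∣u | no _ | p∣v = Equivalence.from (adj⇔ _ _)
      ( u≢v ∘ cong value ∘ injective
      , prime⇒gcd>1 (λ eq → contradiction (subst (1 <_) eq (All.lookup >1 (∈-lookup {xs = σ} _))) λ ()) pp p∣u p∣v)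

    -- A gcd above 1 has a prime divisor, common to both codes. The entry `a` is recorded in order
    -- to conclude later that `p` divides λ(σ).
    edge-block : ∀ {u v} → Adj G u v →
      ∃[ p ] (Prime p × (∃[ a ] (a ∈ σ × p ∣ a)) × u ∈ˢ block p × v ∈ˢ block p)
    edge-block {u} {v} uv
      with isolated? G u in eu | isolated? G v in ev
    ... | yes iu | _ = contradiction uv (iu v)
    ... | _ | yes iv = contradiction (symm G uv) (iv u)
    ... | no ¬iu | no ¬iv with gcd>1⇒prime (proj₂ (Equivalence.to (adj⇔ (u , [ ¬iu ]) (v , [ ¬iv ])) uv))
    ... | p , pp , p∣u , p∣v = p , pp , (_ , ∈-lookup {xs = σ} _ , p∣u)
        , ∈-comprehension⁺ (divisible? p) (subst (λ d → p ∣ code u d) (sym eu) p∣u)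
        , ∈-comprehension⁺ (divisible? p) (subst (λ d → p ∣ code v d) (sym ev) p∣v)

  coding⇒covering : ∀ ones → ∃[ S ] (IsTotalCliqueCovering G S × length S ≤ ω (lcm>1 (ones ++ σ)) + isolatedCount G)
  coding⇒covering ones =
    let S′ , cov , S′≤ = removeDuplicates G {blocks ++ singletons} cl cv ce
    in S′ , cov , ≤-trans S′≤ (≤-reflexive lengths)
    where
    m = lcm>1 (ones ++ σ)
    blocks = map block (primeFactors m)
    singletons = map ⁅_⁆ (isolatedVertices G)
    lengths : length (blocks ++ singletons) ≡ ω m + isolatedCount G
    lengths = trans (length-++ blocks) (cong₂ _+_ (length-map block (primeFactors m)) (length-map ⁅_⁆ (isolatedVertices G)))
    cl : All (IsClique G) (blocks ++ singletons)
    cl = All.++⁺ (All.map⁺ (All.tabulate λ p∈ → block-clique (proj₁ (∈-primeFactors⁻ m p∈))))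
                 (All.map⁺ (All.tabulate λ {v} _ → singleton-clique G v))
    ce : ∀ u v → Adj G u v → Any (λ C → u ∈ˢ C × v ∈ˢ C) (blocks ++ singletons)
    ce u v uv with p , pp , (a , a∈ , p∣a) , u∈ , v∈ ← edge-block uv =
      lose (∈-++⁺ˡ (∈-map⁺ block (∈-primeFactors⁺ (lcm>1≢0 (ones ++ σ)) pp
              (∣-trans p∣a (∣lcm>1 (ones ++ σ) (∈-++⁺ʳ ones a∈) (All.lookup >1 a∈))))))
           (u∈ , v∈)
    cv : ∀ v → Any (v ∈ˢ_) (blocks ++ singletons)
    cv v with isolated? G v
    ... | yes iv = lose (∈-++⁺ʳ blocks (∈-map⁺ ⁅_⁆ (∈-filter⁺ (isolated? G) (∈-allFin v) iv))) (x∈⁅x⁆ v)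
    -- A non-isolated vertex is an endpoint of an edge, and the clique covering that edge contains
    -- it.
    ... | no ¬iv with w , vw ← ¬isolated⇒adj G ¬iv = Any.map proj₁ (ce v w vw)

oneVertex-covering : (G : Graph (Fin 1)) → ∃[ S ] (IsTotalCliqueCovering G S × length S ≤ isolatedCount G)
oneVertex-covering G =
  let S′ , cov , S′≤ = removeDuplicates G {map ⁅_⁆ (isolatedVertices G)} cl cv ce
  in S′ , cov , ≤-trans S′≤ (≤-reflexive (length-map ⁅_⁆ (isolatedVertices G)))
  where
  isolated : ∀ v → Isolated G v
  isolated zero zero = irrefl G
  cl : All (IsClique G) (map ⁅_⁆ (isolatedVertices G))
  cl = All.map⁺ (All.tabulate λ {v} _ → singleton-clique G v)
  cv : ∀ v → Any (v ∈ˢ_) (map ⁅_⁆ (isolatedVertices G))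
  cv v = lose (∈-map⁺ ⁅_⁆ (∈-filter⁺ (isolated? G) (∈-allFin v) (isolated v))) (x∈⁅x⁆ v)
  ce : ∀ u v → Adj G u v → _
  ce u v uv = contradiction uv (isolated u v)

codingSequence⇒covering : ∀ {n} (G : Graph (Fin n)) {σ} → IsCodingSequence G σ →
  ∃[ S ] (IsTotalCliqueCovering G S × length S ≤ ω (lcm>1 σ) + isolatedCount G)
-- Here `ω (lcm>1 (1 ∷ []))` evaluates to 0, so the bound reduces to `isolatedCount G`.
codingSequence⇒covering G (oneVertex refl) = oneVertex-covering G
codingSequence⇒covering G (otherwise _ σ₁ _ entries iso) =
  coding⇒covering G σ₁ (All.map proj₁ entries) iso (replicate (isolatedCount G) 1)

-- From coverings to coding sequences

module _ {n} (G : Graph (Fin n)) {S : List (Subset n)} (cov : IsTotalCliqueCovering G S) where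
  open IsTotalCliqueCovering cov

  private
    HasIsolated : Subset n → Set
    HasIsolated C = ∃[ v ] (Isolated G v × v ∈ˢ C)

    hasIsolated? : Decidable HasIsolated
    hasIsolated? C = Fin.any? λ v → isolated? G v ×-dec (v ∈? C)

    cores : List (Subset n)
    cores = filter (¬? ∘ hasIsolated?) S

  -- A clique containing an isolated vertex `v` equals `⁅ v ⁆`, so these singletons are themselves
  -- members of `S`, and they are pairwise distinct.
  isolatedCount≤ : isolatedCount G ≤ length (filter hasIsolated? S)
  isolatedCount≤ = subst (_≤ length (filter hasIsolated? S)) (length-map ⁅_⁆ (isolatedVertices G))
    (unique⇒length≤ (Unique.map⁺ ⁅⁆-injective (Unique.filter⁺ (isolated? G) (Unique.allFin⁺ n))) singleton∈)
    where
    ⁅⁆-injective : ∀ {u v : Fin n} → ⁅ u ⁆ ≡ ⁅ v ⁆ → u ≡ v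
    ⁅⁆-injective {u} {v} eq = x∈⁅y⁆⇒x≡y v (subst (u ∈ˢ_) eq (x∈⁅x⁆ u))
    singleton∈ : ∀ {C} → C ∈ map ⁅_⁆ (isolatedVertices G) → C ∈ filter hasIsolated? S
    singleton∈ C∈ with v , v∈ , refl ← ∈-map⁻ ⁅_⁆ C∈
                  with C , C∈S , v∈C ← find (coversVertices v) =
      subst (_∈ filter hasIsolated? S) C≡⁅v⁆ (∈-filter⁺ hasIsolated? C∈S (v , isolated , v∈C))
      where
      isolated = proj₂ (∈-filter⁻ (isolated? G) {xs = allFin n} v∈)
      C⊆⁅v⁆ : ∀ {w} → w ∈ˢ C → w ∈ˢ ⁅ v ⁆
      C⊆⁅v⁆ {w} w∈C with v Fin.≟ w
      ... | yes refl = x∈⁅x⁆ v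
      ... | no v≢w = contradiction (All.lookup cliques C∈S v∈C w∈C v≢w) (isolated w)
      C≡⁅v⁆ : C ≡ ⁅ v ⁆
      C≡⁅v⁆ = ⊆-antisym C⊆⁅v⁆ (λ w∈ → subst (_∈ˢ C) (sym (x∈⁅y⁆⇒x≡y v w∈)) v∈C)

  private
    t = length cores

    core : Fin t → Subset n
    core = lookup cores

    prime : Fin t → ℕ
    prime = primeSeq ∘ toℕ

    prime-prime : ∀ i → Prime (prime i)
    prime-prime = primeSeq-prime ∘ toℕ

    prime-injective : ∀ {i j} → prime i ≡ prime j → i ≡ j
    prime-injective = Fin.toℕ-injective ∘ primeSeq-injective

    core-clique : ∀ i → IsClique G (core i)
    core-clique i = All.lookup cliques (proj₁ (∈-filter⁻ (¬? ∘ hasIsolated?) {xs = S} (∈-lookup i)))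

    containing : Fin n → List (Fin t)
    containing v = filter (λ i → v ∈? core i) (allFin t)

    primes : Fin n → List ℕ
    primes v = map prime (containing v)

    primes-prime : ∀ v → All Prime (primes v)
    primes-prime v = All.map⁺ (All.tabulate λ {i} _ → prime-prime i)

    code : Fin n → ℕ
    code v = product (primes v)

    code≢0 : ∀ v → code v ≢ 0
    code≢0 v = ≢-nonZero⁻¹ _ {{productOfPrimes≢0 (primes-prime v)}}

    code-squareFree : ∀ v → SquareFree (code v)
    code-squareFree v = productOfDistinctPrimes-squareFree
      (Unique.map⁺ prime-injective (Unique.filter⁺ _ (Unique.allFin⁺ t))) (primes-prime v)

    ∣code⁺ : ∀ {v i} → v ∈ˢ core i → prime i ∣ code v
    ∣code⁺ {i = i} v∈ = ∈⇒∣product (∈-map⁺ prime (∈-filter⁺ _ (∈-allFin i) v∈))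

    ∣code⁻ : ∀ {v q} → Prime q → q ∣ code v → ∃[ i ] (q ≡ prime i × v ∈ˢ core i)
    ∣code⁻ {v} qp q∣ with ∈-map⁻ prime (factorisationHasAllPrimeFactors qp q∣ (primes-prime v))
    ... | i , i∈ , q≡ = i , q≡ , proj₂ (∈-filter⁻ (λ i → v ∈? core i) {xs = allFin t} i∈)

    -- A clique containing the edge `u` `v` has no isolated vertex: such a vertex would be `u`
    -- itself or adjacent to `u`. Hence discarding the cliques with isolated vertices uncovers no
    -- edge.
    edge-core : ∀ {u v} → Adj G u v → ∃[ i ] (u ∈ˢ core i × v ∈ˢ core i)
    edge-core {u} {v} uv with find (coversEdges u v uv)
    ... | C , C∈S , u∈ , v∈ =
      index C∈ , subst (u ∈ˢ_) (Any.lookup-index C∈) u∈ , subst (v ∈ˢ_) (Any.lookup-index C∈) v∈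
      where
      noIsolated : ¬ HasIsolated C
      noIsolated (w , isol , w∈) with w Fin.≟ u
      ... | yes refl = isol v uv
      ... | no w≢u   = isol u (All.lookup cliques C∈S w∈ u∈ w≢u)
      C∈ : C ∈ cores
      C∈ = ∈-filter⁺ (¬? ∘ hasIsolated?) C∈S noIsolated

    code>1 : ∀ {v} → ¬ Isolated G v → 1 < code v
    code>1 {v} ¬isol with w , vw ← ¬isolated⇒adj G ¬isol with i , v∈ , _ ← edge-core vw =
      prime∣⇒>1 (prime-prime i) (∣code⁺ v∈) (code≢0 v)

    -- The sorted coding sequence and its isomorphism

    open Sort (On.decTotalOrder ≤-decTotalOrder code) using (sort; sort-↭; sort-↗)

    nonIsolated : List (Fin n)
    nonIsolated = filter (¬? ∘ isolated? G) (allFin n)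

    -- The vertices are sorted by code, rather than the codes themselves. Each position then still
    -- determines its vertex, even when several vertices share a code.
    vertices : List (Fin n)
    vertices = sort nonIsolated

    vertices-unique : Unique vertices
    vertices-unique = unique-↭ (↭-sym (sort-↭ nonIsolated)) (Unique.filter⁺ _ (Unique.allFin⁺ n))

    ∈-vertices⁺ : ∀ {v} → ¬ Isolated G v → v ∈ vertices
    ∈-vertices⁺ {v} ¬isol = ∈-resp-↭ (↭-sym (sort-↭ nonIsolated)) (∈-filter⁺ (¬? ∘ isolated? G) (∈-allFin v) ¬isol)

    ∈-vertices⁻ : ∀ {v} → v ∈ vertices → ¬ Isolated G v
    ∈-vertices⁻ v∈ = proj₂ (∈-filter⁻ (¬? ∘ isolated? G) {xs = allFin n} (∈-resp-↭ (sort-↭ nonIsolated) v∈))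

    σ : List ℕ
    σ = map code vertices

    V₁ : Set
    V₁ = Refinement (Fin n) (¬_ ∘ Isolated G)

    -- The proof stored in a refinement is irrelevant; decidability of isolation lets `recompute`
    -- produce a usable one.
    position : V₁ → Fin (length vertices)
    position (v , [ ¬isol ]) = index (∈-vertices⁺ (recompute (¬? (isolated? G v)) ¬isol))

    lookup-position : ∀ r → lookup vertices (position r) ≡ value r
    lookup-position (v , [ ¬isol ]) = sym (Any.lookup-index (∈-vertices⁺ (recompute (¬? (isolated? G v)) ¬isol)))

    to : V₁ → Fin (length σ)
    to r = cast (sym (length-map code vertices)) (position r)

    lookup-to : ∀ r → lookup σ (to r) ≡ code (value r)
    lookup-to r = trans (lookup-map-cast code vertices (position r)) (cong code (lookup-position r))

    value-injective : ∀ {r s : V₁} → value r ≡ value s → r ≡ s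
    value-injective {_ , [ _ ]} {_ , [ _ ]} refl = refl

    to-injective : ∀ {r s} → to r ≡ to s → r ≡ s
    to-injective {r} {s} eq = value-injective (begin
      value r                      ≡⟨ lookup-position r ⟨
      lookup vertices (position r) ≡⟨ cong (lookup vertices) (Fin.toℕ-injective toℕ≡) ⟩
      lookup vertices (position s) ≡⟨ lookup-position s ⟩
      value s                      ∎)
      where
      open ≡-Reasoning
      toℕ≡ : toℕ (position r) ≡ toℕ (position s)
      toℕ≡ = trans (sym (Fin.toℕ-cast _ (position r))) (trans (cong toℕ eq) (Fin.toℕ-cast _ (position s)))

    to-surjective : ∀ j → ∃[ r ] to r ≡ j
    to-surjective j = r , Fin.toℕ-injective (begin
      toℕ (to r)                              ≡⟨ Fin.toℕ-cast _ (position r) ⟩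
      -- `position` finds `r` by membership; it returns to `i` because no vertex is listed twice.
      toℕ (position r)                        ≡⟨ cong toℕ (lookup-injective vertices-unique (lookup-position r)) ⟩
      toℕ i                                   ≡⟨ Fin.toℕ-cast _ j ⟩
      toℕ j                                   ∎)
      where
      open ≡-Reasoning
      i = cast (length-map code vertices) j
      r : V₁
      r = lookup vertices i , [ ∈-vertices⁻ (∈-lookup i) ]

    -- An edge lies in some core, whose prime divides both codes. Conversely, a common prime of two
    -- codes labels a single core, since labels are distinct, and both vertices lie in that clique.
    isomorphism : deleteIsolated G ≅ G[ σ ]
    isomorphism = record
      { bijection = mk⤖ (to-injective , λ j → let (r , eq) = to-surjective j in r , λ { refl → eq })
      ; adj⇔ = λ r s → mk⇔ (forward r s) (backward r s)
      }
      where
      forward : ∀ r s → Adj G (value r) (value s) → Adj G[ σ ] (to r) (to s)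
      forward r s rs = let i , r∈ , s∈ = edge-core rs in
        (λ eq → irrefl G (subst (λ x → Adj G (value r) (value x)) (sym (to-injective {r} {s} eq)) rs)) ,
        subst₂ (λ a b → 1 < gcd a b) (sym (lookup-to r)) (sym (lookup-to s))
          (prime⇒gcd>1 (code≢0 (value r)) (prime-prime i) (∣code⁺ r∈) (∣code⁺ s∈))
      backward : ∀ r s → Adj G[ σ ] (to r) (to s) → Adj G (value r) (value s)
      backward r s (r≢s , 1<g) =
        let q , qp , q∣r , q∣s = gcd>1⇒prime (subst₂ (λ a b → 1 < gcd a b) (lookup-to r) (lookup-to s) 1<g)
            i , q≡i , r∈ = ∣code⁻ {value r} qp q∣r
            j , q≡j , s∈ = ∣code⁻ {value s} qp q∣s
            j≡i = prime-injective (trans (sym q≡j) q≡i)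
        in core-clique i r∈ (subst (λ j → value s ∈ˢ core j) j≡i s∈) (r≢s ∘ cong to ∘ value-injective {r} {s})

    coding : n ≢ 1 → IsCodingSequence G (replicate (isolatedCount G) 1 ++ σ)
    -- Sortedness of `vertices` in the order pulled back along `code` is sortedness of `σ`.
    coding n≢1 = otherwise n≢1 σ (Linked.map⁺ (sort-↗ nonIsolated))
      (All.map⁺ (All.tabulate λ {v} v∈ → code>1 (∈-vertices⁻ v∈) , code-squareFree v)) isomorphism

    -- A prime dividing the lcm divides an entry above 1, hence the code of a vertex, hence is the
    -- label of a core. Equality can fail: the label of an empty core divides no code.
    ω≤cores : ω (lcm>1 (replicate (isolatedCount G) 1 ++ σ)) ≤ t
    ω≤cores = subst (ω m ≤_) (trans (length-map prime (allFin t)) (length-tabulate {n = t} id))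
      (unique⇒length≤ (Unique.filter⁺ (isPrimeFactor? m) (Unique.upTo⁺ (suc m))) factor∈)
      where
      m = lcm>1 (replicate (isolatedCount G) 1 ++ σ)
      factor∈ : ∀ {q} → q ∈ primeFactors m → q ∈ map prime (allFin t)
      factor∈ q∈ with qp , q∣m ← ∈-primeFactors⁻ m q∈
                 with prime∣lcm>1 (replicate (isolatedCount G) 1 ++ σ) qp q∣m
      ... | a , a∈ , 1<a , q∣a with ∈-++⁻ (replicate (isolatedCount G) 1) a∈
      ... | inj₁ a∈1 = contradiction (All.lookup {P = 1 ≡_} (All.replicate⁺ (isolatedCount G) refl) a∈1) (<⇒≢ 1<a)
      ... | inj₂ a∈σ with v , _ , refl ← ∈-map⁻ code a∈σ with i , refl , _ ← ∣code⁻ {v} qp q∣a =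
        ∈-map⁺ prime (∈-allFin i)

  covering⇒codingSequence : ∃[ τ ] (IsCodingSequence G τ × ω (lcm>1 τ) + isolatedCount G ≤ length S)
  covering⇒codingSequence with n ≟ 1
  ... | yes n≡1 = 1 ∷ [] , oneVertex n≡1 , ≤-trans isolatedCount≤ (length-filter hasIsolated? S)
  ... | no n≢1 = _ , coding n≢1 ,
    -- The cores and the cliques with an isolated vertex partition `S`, so the two bounds add up to
    -- its length.
    ≤-trans (+-mono-≤ ω≤cores isolatedCount≤) (≤-reflexive (length-filter-¬ hasIsolated? S))

-- Comparison of the two minima

theorem2 : ∀ (n : ℕ) (G : Graph (Fin n)) →
    ∃[ θ ] ∃[ k ] (IsTotalCliqueCoveringNumber G θ × IsMinimumPrimeCount G k × θ ≡ k + isolatedCount G)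
theorem2 n G
  with θ , (S , cov , refl) , θ≤ ← cliqueCoveringNumber G
  with τ , coding , τ≤ ← covering⇒codingSequence G cov
  -- With `s` isolated vertices, `ω (lcm>1 τ) + s ≤ length S ≤ ω (lcm>1 τ′) +
  -- s` for every coding sequence `τ′`. Cancelling `s` shows that `τ` is optimal, and `τ′` = `τ`
  -- gives the equality.
  = θ , ω (lcm>1 τ) , ((S , cov , refl) , θ≤) , ((τ , coding , refl) , minimal) , ≤-antisym (θ≤ω coding) τ≤
  where
  θ≤ω : ∀ {τ′} → IsCodingSequence G τ′ → length S ≤ ω (lcm>1 τ′) + isolatedCount G
  θ≤ω coding′ with S′ , cov′ , S′≤ ← codingSequence⇒covering G coding′ = ≤-trans (θ≤ _ (S′ , cov′ , refl)) S′≤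
  minimal : ∀ k → ∃[ τ′ ] (IsCodingSequence G τ′ × k ≡ ω (lcm>1 τ′)) → ω (lcm>1 τ) ≤ k
  minimal _ (τ′ , coding′ , refl) = +-cancelʳ-≤ (isolatedCount G) _ _ (≤-trans τ≤ (θ≤ω coding′))
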